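{- Let $G=(V,E)$ be a finite, simple, connected graph that is AT-free and contains no bad claw as an induced subgraph, and let $s$ be an admissible vertex of $G$. Then every LBFS order of $G$ starting in $s$ is an AT-free order and a monotone dominating pair order of $G$.
   Context: An asteroidal triple is an independent set of three vertices such that for any two of them there is a path between them containing no neighbour of the third; $G$ is AT-free if it has none. A path $P$ avoids a vertex $v$ if $v$ has no neighbour on $P$. The domination betweenness $\mathcal{B}_D(G)$ is the set of triples $(x,y,z)$ of distinct vertices such that there is a chordless $x$-$y$-path avoiding $z$ and a chordless $y$-$z$-path avoiding $x$. A vertex $y$ is admissible if there are no $x,z$ with $(x,y,z)\in\mathcal{B}_D(G)$. A bad claw is a set of vertices $a,b,z,c$ inducing a claw $K_{1,3}$ with base (centre) $c$ and prongs $a,b,z$ such that $(a,z,b)\in\mathcal{B}_D(G)$. An AT-free order is an ordering $\tau$ of $V$ such that for every $(x,y,z)\in\mathcal{B}_D(G)$ we have $y\prec_\tau x$ or $y\prec_\tau z$. Two vertices $a,b$ form a dominating pair of a graph $H$ if the vertex set of every $a$-$b$-path in $H$ is a dominating set of $H$. An ordering $\tau=(v_1,\ldots,v_n)$ is a monotone dominating pair order if for every $i$ the vertices $v_1,v_i$ form a dominating pair of $G[\{v_1,\ldots,v_i\}]$. Lexicographic BFS (LBFS) from $s$: give $s$ label $n$ and all other vertices the empty label; for $i=1,\ldots,n$ pick an unnumbered vertex $v$ with lexicographically largest label (ties broken arbitrarily; the first pick is $s$), set $\tau(i)=v$, and append $n-i$ to the label of every unnumbered neighbour of $v$. An LBFS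 order starting in $s$ is any ordering so produced. -}

module Defs where

open import Data.Nat using (ℕ; zero; suc; _<_; _≤_; _∸_; _<ᵇ_)
open import Data.Fin using (Fin; toℕ; inject₁; fromℕ)
open import Data.Bool using (Bool; T; if_then_else_; _∧_)
open import Data.List using (List; []; _∷_; _++_; concatMap; allFin)
open import Data.Product using (Σ; ∃; ∃-syntax; _×_; _,_)
open import Data.Sum using (_⊎_)
open import Relation.Nullary using (¬_; does)
open import Relation.Binary.PropositionalEquality using (_≡_; _≢_)
open import Function.Definitions using (Injective)
import Data.Fin as F

record Graph (n : ℕ) : Set where
  field
    adj   : Fin n → Fin n → Bool
    sym   : ∀ u v → adj u v ≡ adj v u
    irrefl : ∀ v → adj v v ≡ Data.Bool.false

open Graph public

data _<lex_ : List ℕ → List ℕ → Set where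
  []<∷ : ∀ {y ys} → [] <lex (y ∷ ys)
  head< : ∀ {x y xs ys} → x < y → (x ∷ xs) <lex (y ∷ ys)
  tail< : ∀ {x xs ys} → xs <lex ys → (x ∷ xs) <lex (x ∷ ys)

firstOf : ∀ {n} → Fin n → Fin n
firstOf {suc m} _ = Fin.zero

module _ {n : ℕ} (G : Graph n) where

  Adj : Fin n → Fin n → Set
  Adj u v = T (adj G u v)

  IsWalk : (k : ℕ) → (Fin (suc k) → Fin n) → Set
  IsWalk k p = ∀ (i : Fin k) → Adj (p (inject₁ i)) (p (Fin.suc i))

  IsPath : (k : ℕ) → (Fin (suc k) → Fin n) → Set
  IsPath k p = IsWalk k p × Injective _≡_ _≡_ p

  IsChordless : (k : ℕ) → (Fin (suc k) → Fin n) → Set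
  IsChordless k p = IsPath k p ×
    (∀ (i j : Fin (suc k)) → toℕ i < toℕ j → Adj (p i) (p j) → toℕ j ≡ suc (toℕ i))

  Ends : (k : ℕ) → (Fin (suc k) → Fin n) → Fin n → Fin n → Set
  Ends k p x y = (p Fin.zero ≡ x) × (p (fromℕ k) ≡ y)

  Avoids : (k : ℕ) → (Fin (suc k) → Fin n) → Fin n → Set
  Avoids k p v = ∀ (i : Fin (suc k)) → ¬ Adj v (p i)

  Connected : Set
  Connected = ∀ (x y : Fin n) → ∃[ k ] Σ (Fin (suc k) → Fin n) λ p → IsPath k p × Ends k p x y

  PathAvoiding : Fin n → Fin n → Fin n → Set
  PathAvoiding x y z = ∃[ k ] Σ (Fin (suc k) → Fin n) λ p →
    IsPath k p × Ends k p x y × Avoids k p z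

  AsteroidalTriple : Fin n → Fin n → Fin n → Set
  AsteroidalTriple a b c =
    (a ≢ b) × (b ≢ c) × (a ≢ c) ×
    (¬ Adj a b) × (¬ Adj b c) × (¬ Adj a c) ×
    PathAvoiding a b c × PathAvoiding b c a × PathAvoiding a c b

  ATFree : Set
  ATFree = ∀ a b c → ¬ AsteroidalTriple a b c

  ChordlessAvoiding : Fin n → Fin n → Fin n → Set
  ChordlessAvoiding x y z = ∃[ k ] Σ (Fin (suc k) → Fin n) λ p →
    IsChordless k p × Ends k p x y × Avoids k p z

  DomBetween : Fin n → Fin n → Fin n → Set
  DomBetween x y z = (x ≢ y) × (y ≢ z) × (x ≢ z) ×
    ChordlessAvoiding x y z × ChordlessAvoiding y z x

  Admissible : Fin n → Set
  Admissible y = ∀ x z → ¬ DomBetween x y z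

  BadClaw : Fin n → Fin n → Fin n → Fin n → Set
  BadClaw a b z c =
    (a ≢ b) × (a ≢ z) × (b ≢ z) ×
    Adj c a × Adj c b × Adj c z ×
    (¬ Adj a b) × (¬ Adj a z) × (¬ Adj b z) ×
    DomBetween a z b

  NoBadClaw : Set
  NoBadClaw = ∀ a b z c → ¬ BadClaw a b z c

  -- Orderings: τ : Fin n → Fin n bijective, τ i = the (i+1)-th vertex.

  IsOrdering : (Fin n → Fin n) → Set
  IsOrdering τ = Injective _≡_ _≡_ τ

  Before : (Fin n → Fin n) → Fin n → Fin n → Set
  Before τ x y = ∃[ i ] ∃[ j ] (τ i ≡ x) × (τ j ≡ y) × (toℕ i < toℕ j)

  ATFreeOrder : (Fin n → Fin n) → Set
  ATFreeOrder τ = ∀ x y z → DomBetween x y z → Before τ y x ⊎ Before τ y z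

  DominatingPairIn : (Fin n → Set) → Fin n → Fin n → Set
  DominatingPairIn S a b =
    ∀ (k : ℕ) (p : Fin (suc k) → Fin n) →
      IsPath k p → Ends k p a b → (∀ i → S (p i)) →
      ∀ v → S v → ∃[ i ] (p i ≡ v ⊎ Adj v (p i))

  Prefix : (Fin n → Fin n) → Fin n → Fin n → Set
  Prefix τ i v = ∃[ j ] (toℕ j ≤ toℕ i) × (τ j ≡ v)

  MonotoneDomPairOrder : (Fin n → Fin n) → Set
  MonotoneDomPairOrder τ =
    ∀ (i : Fin n) → DominatingPairIn (Prefix τ i) (τ (firstOf i)) (τ i)

  -- Lexicographic BFS.
  -- Label of vertex v after the vertices τ 0, ..., τ (i-1) have been
  -- numbered (0-based step k corresponds to the paper's step k+1, which
  -- appends n - (k+1) to the labels of unnumbered neighbours of τ k).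
  -- The start vertex s initially has label (n), all others the empty label.

  label : Fin n → (Fin n → Fin n) → ℕ → Fin n → List ℕ
  label s τ i v =
    (if does (v F.≟ s) then n ∷ [] else [])
    ++ concatMap (λ k → if (toℕ k <ᵇ i) ∧ adj G (τ k) v
                         then (n ∸ suc (toℕ k)) ∷ [] else [])
                 (allFin n)

  IsLBFS : Fin n → (Fin n → Fin n) → Set
  IsLBFS s τ = IsOrdering τ ×
    (∀ (i : Fin n) → τ (firstOf i) ≡ s) ×
    (∀ (i j : Fin n) → toℕ i < toℕ j →
       ¬ (label s τ (toℕ i) (τ i) <lex label s τ (toℕ i) (τ j)))

{-# OPTIONS --safe #-}
module Submission where

-- Say that u hits a walk if the walk contains u or a neighbour of u.  The key
-- fact is that, in an LBFS order from an admissible s, a vertex u hits every walk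
-- from s to a later vertex v; for v = v_i this is the dominating pair property.
-- Given a walk missing u, admissibility makes v hit every s-u walk, and following
-- first label differences three times (between u and v, then among earlier
-- vertices) produces an s-u walk that v misses.
--
-- For the AT-free order, let (x,y,z) be a domination betweenness with y last and
-- let w be the first vertex in N[x] ∪ N[z] on some s-y walk.  If w is adjacent to x,
-- continuing through x to y along the path avoiding z gives an s-y walk, which z
-- can hit only in w; so w is adjacent to both x and z.  If w is also adjacent to y
-- this is a bad claw, and otherwise x, y, z is an asteroidal triple.

open import Defs hiding (sym)
open import Data.Bool using (Bool; true; false; T; if_then_else_; _∧_)
open import Data.Bool.Properties using (T?; T-≡)
import Data.Bool.Properties as Bool
open import Data.Empty using (⊥; ⊥-elim)
open import Data.Fin using (Fin; zero; suc; toℕ; fromℕ; fromℕ<; inject₁)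
open import Data.Fin.Properties using (_≟_; any?; injective⇒≤; toℕ-injective; toℕ<n; toℕ-inject; toℕ-fromℕ<; ¬∀⟶∃¬-smallest)
open import Data.List using (List; []; _∷_; concatMap; tabulate)
open import Data.Nat using (ℕ; zero; suc; _<_; _∸_; _<ᵇ_; s≤s; z<s)
open import Data.Nat.Induction using (<-rec)
open import Data.Nat.Properties using (_<?_; <-cmp; <-trans; <-irrefl; <-asym; <⇒<ᵇ; n≮0; 1+n≰n; suc-injective; ∸-monoʳ-<; m≤n⇒m<n∨m≡n)
open import Data.Product using (Σ; ∃; _×_; _,_; proj₁; proj₂)
open import Data.Sum using (_⊎_; inj₁; inj₂; [_,_]′)
import Data.Vec.Functional as Vector
open import Function using (_∘_; id)
open import Function.Bundles using (Equivalence)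
open import Function.Definitions using (Injective)
open import Relation.Binary.Definitions using (tri<; tri≈; tri>)
open import Relation.Binary.PropositionalEquality using (_≡_; _≢_; refl; sym; trans; cong; subst; subst₂)
open import Relation.Nullary using (¬_; Dec; yes; no; contradiction)
open import Relation.Nullary.Decidable using (_⊎-dec_; dec-false)

-- Pigeonhole: with a missed value `y` put in front, `f` would inject `Fin (suc n)` into `Fin n`.
injective⇒surjective : ∀ {n} {f : Fin n → Fin n} → Injective _≡_ _≡_ f →
  ∀ y → ∃ λ i → f i ≡ y
injective⇒surjective {n} {f} f-inj y with any? (λ i → f i ≟ y)
... | yes found = found
... | no  none  = ⊥-elim (1+n≰n (injective⇒≤ {f = y Vector.∷ f} inj))
  where
  inj : Injective _≡_ _≡_ (y Vector.∷ f)
  inj {zero}  {zero}  _  = refl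
  inj {zero}  {suc j} eq = ⊥-elim (none (j , sym eq))
  inj {suc i} {zero}  eq = ⊥-elim (none (i , eq))
  inj {suc i} {suc j} eq = cong suc (f-inj eq)

-- Lexicographic comparison of labels

module _ {A : Set} (c : A → ℕ) where

  select : (A → Bool) → A → List ℕ
  select a k = if a k then c k ∷ [] else []

  -- `ys` can be arbitrary: the left list is either empty or decided at its first entry.
  selected<lex∷ : ∀ {m} (h : Fin m → A) (a : A → Bool) {x ys} →
    (∀ k → c (h k) < x) → concatMap (select a) (tabulate h) <lex (x ∷ ys)
  selected<lex∷ {zero}  h a c<x = []<∷
  selected<lex∷ {suc m} h a c<x with a (h zero)
  ... | true  = head< (c<x zero)
  ... | false = selected<lex∷ (h ∘ suc) a (c<x ∘ suc)

  -- Both lists share the entries selected before `d`. The right one continues with the weight of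
  -- `d`, and decreasing weights leave only smaller ones for the left. Keeping `h` general lets the
  -- induction shift the index.
  first-difference⇒<lex : ∀ {m} (h : Fin m → A) (a b : A → Bool) →
    (∀ i j → toℕ i < toℕ j → c (h j) < c (h i)) →
    (d : Fin m) → (∀ k → toℕ k < toℕ d → a (h k) ≡ b (h k)) →
    a (h d) ≡ false → b (h d) ≡ true →
    concatMap (select a) (tabulate h) <lex concatMap (select b) (tabulate h)
  first-difference⇒<lex h a b c-dec zero agree ad bd rewrite ad | bd =
    selected<lex∷ (h ∘ suc) a (λ k → c-dec zero (suc k) z<s)
  first-difference⇒<lex h a b c-dec (suc d) agree ad bd
    with rec ← first-difference⇒<lex (h ∘ suc) a b
                 (λ i j i<j → c-dec (suc i) (suc j) (s≤s i<j)) d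
                 (λ k k<d → agree (suc k) (s≤s k<d)) ad bd
    rewrite agree zero z<s with b (h zero)
  ... | true  = tail< rec
  ... | false = rec

module _ {n : ℕ} (G : Graph n) where

  Adj-sym : ∀ {u v} → Adj G u v → Adj G v u
  Adj-sym {u} {v} = subst T (Graph.sym G u v)

  ¬Adj-refl : ∀ {v} → ¬ Adj G v v
  ¬Adj-refl {v} = subst T (irrefl G v)

  Adj? : ∀ u v → Dec (Adj G u v)
  Adj? u v = T? (adj G u v)

  -- Walks through vertices satisfying a predicate

  data Walk (P : Fin n → Set) (x : Fin n) : Fin n → Set where
    start  : P x → Walk P x x
    extend : ∀ {y z} → Walk P x y → Adj G y z → P z → Walk P x z

  walk-map : ∀ {P Q : Fin n → Set} {x y} → (∀ {w} → P w → Q w) → Walk P x y → Walk Q x y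
  walk-map f (start Px)        = start (f Px)
  walk-map f (extend W y~z Pz) = extend (walk-map f W) y~z (f Pz)

  walk-source : ∀ {P : Fin n → Set} {x y} → Walk P x y → P x
  walk-source (start Px)     = Px
  walk-source (extend W _ _) = walk-source W

  walk-target : ∀ {P : Fin n → Set} {x y} → Walk P x y → P y
  walk-target (start Px)      = Px
  walk-target (extend _ _ Pz) = Pz

  walk-++ : ∀ {P : Fin n → Set} {x y z} → Walk P x y → Walk P y z → Walk P x z
  walk-++ W (start _)          = W
  walk-++ W (extend V y~z Pz) = extend (walk-++ W V) y~z Pz

  walk-reverse : ∀ {P : Fin n → Set} {x y} → Walk P x y → Walk P y x
  walk-reverse (start Px)        = start Px
  walk-reverse (extend W y~z Pz) =
    walk-++ (extend (start Pz) (Adj-sym y~z) (walk-target W)) (walk-reverse W)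

  IsWalk⇒Walk : ∀ {P : Fin n → Set} k p → IsWalk G k p → (∀ i → P (p i)) →
    Walk P (p zero) (p (fromℕ k))
  IsWalk⇒Walk zero    p _  P-all = start (P-all zero)
  IsWalk⇒Walk (suc k) p p~ P-all =
    extend (IsWalk⇒Walk k (p ∘ inject₁) (p~ ∘ inject₁) (P-all ∘ inject₁))
           (p~ (fromℕ k)) (P-all (suc (fromℕ k)))

  -- Nothing is asked of `w` itself: it is the vertex at which a condition may first break.
  Approach : (P : Fin n → Set) → Fin n → Fin n → Set
  Approach P x w = w ≡ x ⊎ ∃ λ w′ → Walk P x w′ × Adj G w′ w

  Approach⇒Walk : ∀ {P R : Fin n → Set} {x w} → (∀ {t} → P t → R t) → R w →
    Approach P x w → Walk R x w
  Approach⇒Walk f Rw (inj₁ refl)           = start Rw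
  Approach⇒Walk f Rw (inj₂ (_ , W , w′~w)) = extend (walk-map f W) w′~w Rw

  FirstHit : (P Q : Fin n → Set) → Fin n → Set
  FirstHit P Q x = ∃ λ w → P w × Q w × Approach (λ t → P t × ¬ Q t) x w

  miss-or-hit : ∀ {P Q : Fin n → Set} {x y} → (∀ w → Dec (Q w)) → Walk P x y →
    Walk (λ t → P t × ¬ Q t) x y ⊎ FirstHit P Q x
  miss-or-hit {x = x} Q? (start Px) with Q? x
  ... | yes Qx = inj₂ (x , Px , Qx , inj₁ refl)
  ... | no ¬Qx = inj₁ (start (Px , ¬Qx))
  miss-or-hit Q? (extend {z = z} W y~z Pz) with miss-or-hit Q? W
  ... | inj₂ hit = inj₂ hit
  ... | inj₁ W′ with Q? z
  ...   | yes Qz = inj₂ (z , Pz , Qz , inj₂ (_ , W′ , y~z))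
  ...   | no ¬Qz = inj₁ (extend W′ y~z (Pz , ¬Qz))

  first-hit : ∀ {P Q : Fin n → Set} {x y} → (∀ w → Dec (Q w)) → Walk P x y → Q y →
    FirstHit P Q x
  first-hit Q? W Qy with miss-or-hit Q? W
  ... | inj₁ W′  = contradiction Qy (proj₂ (walk-target W′))
  ... | inj₂ hit = hit

  FirstHit⇒Walk : ∀ {P Q : Fin n → Set} {x} → FirstHit P Q x → ∃ λ w → Walk P x w × Q w
  FirstHit⇒Walk (w , Pw , Qw , loc) = w , Approach⇒Walk proj₁ Pw loc , Qw

  -- Chordless paths

  ChordlessIn : (Fin n → Set) → (k : ℕ) → (Fin (suc k) → Fin n) → Fin n → Set
  ChordlessIn P k p x = IsChordless G k p × p (fromℕ k) ≡ x × (∀ i → P (p i))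

  chordless-tail : ∀ {P k p x} → ChordlessIn P (suc k) p x → ChordlessIn P k (p ∘ suc) x
  chordless-tail (((p~ , p-inj) , p-chord) , end , P-all) =
    (((p~ ∘ suc) , suc-inj ∘ p-inj) ,
      λ i j i<j adj → suc-injective (p-chord (suc i) (suc j) (s≤s i<j) adj)) ,
    end , P-all ∘ suc
    where
    suc-inj : ∀ {m} {i j : Fin m} → suc i ≡ suc j → i ≡ j
    suc-inj refl = refl

  chordless-cons : ∀ {P k p x z} → ChordlessIn P k p x → P z → Adj G z (p zero) →
    (∀ i → z ≢ p i) → (∀ i → i ≢ zero → ¬ Adj G z (p i)) →
    ChordlessIn P (suc k) (z Vector.∷ p) x
  chordless-cons {P} {k} {p} {x} {z} (((p~ , p-inj) , p-chord) , end , P-all) Pz z~p₀ z∉p z≁p =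
    ((q~ , q-inj) , q-chord) , end , q-all
    where
    q : Fin (suc (suc k)) → Fin n
    q = z Vector.∷ p

    q~ : IsWalk G (suc k) q
    q~ zero    = z~p₀
    q~ (suc i) = p~ i

    q-inj : Injective _≡_ _≡_ q
    q-inj {zero}  {zero}  _  = refl
    q-inj {zero}  {suc j} eq = ⊥-elim (z∉p j eq)
    q-inj {suc i} {zero}  eq = ⊥-elim (z∉p i (sym eq))
    q-inj {suc i} {suc j} eq = cong suc (p-inj eq)

    q-chord : ∀ i j → toℕ i < toℕ j → Adj G (q i) (q j) → toℕ j ≡ suc (toℕ i)
    q-chord zero    (suc zero)    _ _ = refl
    q-chord zero    (suc (suc j)) _ a = ⊥-elim (z≁p (suc j) (λ ()) a)
    q-chord (suc i) (suc j) (s≤s i<j) a = cong suc (p-chord i j i<j a)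

    q-all : ∀ i → P (q i)
    q-all zero    = Pz
    q-all (suc i) = P-all i

  Touches : Fin n → Fin n → Set
  Touches v w = w ≡ v ⊎ Adj G v w

  Touches? : ∀ v w → Dec (Touches v w)
  Touches? v w = (w ≟ v) ⊎-dec Adj? v w

  -- Cutting at the last touch leaves no neighbour of `z` past the first vertex, so `z`, unless
  -- already first, can be prepended without creating a chord.
  last-touch : ∀ {P : Fin n → Set} {x} z k p → ChordlessIn P k p x → (∃ λ i → Touches z (p i)) →
    ∃ λ k′ → Σ (Fin (suc k′) → Fin n) λ p′ → ChordlessIn P k′ p′ x ×
      Touches z (p′ zero) × (∀ i → i ≢ zero → ¬ Touches z (p′ i))
  last-touch z zero    p C (zero , t) =
    zero , p , C , t , λ { zero i≢0 → contradiction refl i≢0 }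
  last-touch {P} z (suc k) p C (i , t) with any? (λ j → Touches? z (p (suc j)))
  ... | yes later = last-touch {P} z k (p ∘ suc) (chordless-tail {P} {p = p} C) later
  ... | no  none  = suc k , p , C , touch-zero i t , λ where
      zero    i≢0   → contradiction refl i≢0
      (suc j) _   t → none (j , t)
    where
    touch-zero : ∀ i → Touches z (p i) → Touches z (p zero)
    touch-zero zero    t = t
    touch-zero (suc j) t = contradiction (j , t) none

  -- The path comes out reversed because walks grow at their end and paths at their front.
  Walk⇒chordless : ∀ {P x y} → Walk P x y →
    ∃ λ k → Σ (Fin (suc k) → Fin n) λ p → IsChordless G k p × Ends G k p y x × (∀ i → P (p i))
  Walk⇒chordless {P} {x} (start Px) =
    zero , (λ _ → x) ,
    (((λ ()) , λ { {zero} {zero} _ → refl }) , λ { zero zero () }) ,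
    (refl , refl) , λ _ → Px
  Walk⇒chordless {P} {x} (extend {z = z} W y~z Pz)
    with k , p , C , (p₀ , end) , P-all ← Walk⇒chordless W
    with last-touch {P} z k p (C , end , P-all)
           (zero , inj₂ (subst (Adj G z) (sym p₀) (Adj-sym y~z)))
  ... | k′ , p′ , (C′ , end′ , all′) , inj₁ p′₀ , _ = k′ , p′ , C′ , (p′₀ , end′) , all′
  ... | k′ , p′ , C′ , inj₂ z~p′₀ , later
    with C″ , end″ , all″ ← chordless-cons {P} {p = p′} C′ Pz z~p′₀
           (λ { zero eq → ¬Adj-refl (subst (Adj G z) (sym eq) z~p′₀)
              ; (suc i) eq → later (suc i) (λ ()) (inj₁ (sym eq)) })
           (λ i i≢0 a → later i i≢0 (inj₂ a))
    = suc k′ , z Vector.∷ p′ , C″ , (refl , end″) , all″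

  -- Walks missed by a vertex, and admissibility

  Miss : Fin n → Fin n → Set
  Miss v w = ¬ Touches v w

  Walk⇒ChordlessAvoiding : ∀ {x y v} → Walk (Miss v) x y → ChordlessAvoiding G y x v
  Walk⇒ChordlessAvoiding W with k , p , C , ends , miss ← Walk⇒chordless W =
    k , p , C , ends , λ i a → miss i (inj₂ a)

  ChordlessAvoiding⇒PathAvoiding : ∀ {x y v} → ChordlessAvoiding G x y v → PathAvoiding G x y v
  ChordlessAvoiding⇒PathAvoiding (k , p , (path , _) , rest) = k , p , path , rest

  -- Entering `v` would take a step from a neighbour of `v`, so only the start has to be kept off
  -- `v`.
  avoid⇒miss : ∀ {x y v} → x ≢ v → Walk (λ w → ¬ Adj G v w) x y → Walk (Miss v) x y
  avoid⇒miss x≢v (start v≁x) = start [ x≢v , v≁x ]′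
  avoid⇒miss x≢v (extend W y~z v≁z) =
    extend (avoid⇒miss x≢v W) y~z
           [ (λ { refl → walk-target W (Adj-sym y~z) }) , v≁z ]′

  PathAvoiding⇒Walk : ∀ {x y v} → x ≢ v → PathAvoiding G x y v → Walk (Miss v) x y
  PathAvoiding⇒Walk x≢v (k , p , (p~ , _) , (refl , refl) , avoids) =
    avoid⇒miss x≢v (IsWalk⇒Walk k p p~ avoids)

  -- The two walks shorten to chordless paths that put `s` between `u` and `v` in the domination
  -- betweenness.
  admissible⇒no-mutual-miss : ∀ {s u v} → Admissible G s → u ≢ v →
    Walk (Miss u) s v → ¬ Walk (Miss v) s u
  admissible⇒no-mutual-miss adm u≢v W V =
    adm _ _ ((λ eq → walk-source W (inj₁ (sym eq))) , (λ eq → walk-source V (inj₁ eq)) , u≢v ,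
             Walk⇒ChordlessAvoiding V , Walk⇒ChordlessAvoiding (walk-reverse W))

  -- Positions and first label differences in an LBFS order

  module LBFS (s : Fin n) (τ : Fin n → Fin n) (lbfs : IsLBFS G s τ) where

    τ-inj : Injective _≡_ _≡_ τ
    τ-inj = proj₁ lbfs

    pos : Fin n → Fin n
    pos v = proj₁ (injective⇒surjective τ-inj v)

    τ-pos : ∀ v → τ (pos v) ≡ v
    τ-pos v = proj₂ (injective⇒surjective τ-inj v)

    infix 4 _≺_
    _≺_ : Fin n → Fin n → Set
    u ≺ v = toℕ (pos u) < toℕ (pos v)

    pos-τ : ∀ i → pos (τ i) ≡ i
    pos-τ i = τ-inj (τ-pos (τ i))

    ≺-connex : ∀ u v → u ≢ v → u ≺ v ⊎ v ≺ u
    ≺-connex u v u≢v with <-cmp (toℕ (pos u)) (toℕ (pos v))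
    ... | tri< u≺v _ _ = inj₁ u≺v
    ... | tri> _ _ v≺u = inj₂ v≺u
    ... | tri≈ _ eq _  =
      contradiction (trans (sym (τ-pos u)) (trans (cong τ (toℕ-injective eq)) (τ-pos v))) u≢v

    ≺⇒≢ : ∀ {u v} → u ≺ v → u ≢ v
    ≺⇒≢ u≺v refl = <-irrefl refl u≺v

    ⊀s : ∀ {v} → ¬ v ≺ s
    ⊀s {v} v≺s = n≮0 (subst (toℕ (pos v) <_) pos-s v≺s)
      where
      toℕ-firstOf : ∀ {m} (i : Fin m) → toℕ (firstOf i) ≡ 0
      toℕ-firstOf {suc m} _ = refl
      pos-s : toℕ (pos s) ≡ 0
      pos-s = trans (cong (toℕ ∘ pos) (sym (proj₁ (proj₂ lbfs) v)))
                    (trans (cong toℕ (pos-τ (firstOf v))) (toℕ-firstOf v))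

    label-select : ∀ i v → v ≢ s →
      label G s τ i v ≡
      concatMap (select (λ k → n ∸ suc (toℕ k)) (λ k → (toℕ k <ᵇ i) ∧ adj G (τ k) v)) (tabulate id)
    label-select i v v≢s rewrite dec-false (v ≟ s) v≢s = refl

    weight-decreasing : ∀ (i j : Fin n) → toℕ i < toℕ j → n ∸ suc (toℕ j) < n ∸ suc (toℕ i)
    weight-decreasing i j i<j = ∸-monoʳ-< (s≤s i<j) (toℕ<n j)

    FirstDifference : (u v d : Fin n) → Set
    FirstDifference u v d = Adj G d u × ¬ Adj G d v × (∀ {m} → m ≺ d → adj G m u ≡ adj G m v)

    -- When `u` is picked its label is not below that of `v`, so the first vertex telling them apart
    -- is adjacent to `u`. It precedes `k` because `k` tells them apart in favour of `v`.
    first-difference : ∀ {k u v} → k ≺ u → u ≺ v → Adj G k v → ¬ Adj G k u →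
      ∃ λ d → d ≺ k × FirstDifference u v d
    first-difference {k} {u} {v} k≺u u≺v k~v k≁u
      with d , differ , smaller ← ¬∀⟶∃¬-smallest n
             (λ i → adj G (τ i) u ≡ adj G (τ i) v)
             (λ i → adj G (τ i) u Bool.≟ adj G (τ i) v)
             (λ all → k≁u (subst T (sym (subst (λ t → adj G t u ≡ adj G t v) (τ-pos k) (all (pos k)))) k~v))
      = cases refl refl
      where
      agree : ∀ i → toℕ i < toℕ d → adj G (τ i) u ≡ adj G (τ i) v
      agree i i<d = subst (λ t → adj G (τ t) u ≡ adj G (τ t) v)
        (toℕ-injective (trans (toℕ-inject (fromℕ< i<d)) (toℕ-fromℕ< i<d)))
        (smaller (fromℕ< i<d))

      agree≺ : ∀ {m} → m ≺ τ d → adj G m u ≡ adj G m v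
      agree≺ {m} m≺d = subst (λ t → adj G t u ≡ adj G t v) (τ-pos m)
        (agree (pos m) (subst (λ t → toℕ (pos m) < toℕ t) (pos-τ d) m≺d))

      k≢τd : Adj G (τ d) u → k ≢ τ d
      k≢τd d~u refl = k≁u d~u

      k⊀τd : ¬ k ≺ τ d
      k⊀τd k≺d = k≁u (subst T (sym (agree≺ k≺d)) k~v)

      d<pos-u : toℕ d < toℕ (pos u)
      d<pos-u with k ≟ τ d
      ... | yes refl = subst (λ t → toℕ t < toℕ (pos u)) (pos-τ d) k≺u
      ... | no  k≢d  with ≺-connex k (τ d) k≢d
      ...   | inj₁ k≺d = contradiction k≺d k⊀τd
      ...   | inj₂ d≺k = subst (λ t → toℕ t < toℕ (pos u)) (pos-τ d) (<-trans d≺k k≺u)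

      -- Vertices before `u` are already numbered when `u` is picked, so they pass the cut-off in
      -- `label`.
      below : ∀ i w → toℕ i < toℕ (pos u) →
        (toℕ i <ᵇ toℕ (pos u)) ∧ adj G (τ i) w ≡ adj G (τ i) w
      below i w i<u rewrite Equivalence.to T-≡ (<⇒<ᵇ i<u) = refl

      cases : ∀ {b c} → adj G (τ d) u ≡ b → adj G (τ d) v ≡ c →
        ∃ λ d → d ≺ k × FirstDifference u v d
      cases {true}  {true}  du dv = contradiction (trans du (sym dv)) differ
      cases {false} {false} du dv = contradiction (trans du (sym dv)) differ
      cases {true}  {false} du dv =
        τ d , [ (λ k≺d → contradiction k≺d k⊀τd) , id ]′ (≺-connex k (τ d) (k≢τd d~u)) ,
        d~u , (λ d~v → subst T dv d~v) , agree≺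
        where
        d~u : Adj G (τ d) u
        d~u = subst T (sym du) _
      cases {false} {true} du dv = ⊥-elim (proj₂ (proj₂ lbfs) (pos u) (pos v) u≺v
        (subst₂ (λ x y → label G s τ (toℕ (pos u)) x <lex label G s τ (toℕ (pos u)) y)
                (sym (τ-pos u)) (sym (τ-pos v))
        (subst₂ _<lex_ (sym (label-select (toℕ (pos u)) u λ { refl → ⊀s k≺u }))
                       (sym (label-select (toℕ (pos u)) v λ { refl → ⊀s u≺v }))
          (first-difference⇒<lex _ id _ _ weight-decreasing d
            (λ i i<d → trans (below i u (<-trans i<d d<pos-u))
                      (trans (agree i i<d) (sym (below i v (<-trans i<d d<pos-u)))))
            (trans (below d u d<pos-u) du) (trans (below d v d<pos-u) dv)))))

    -- Every vertex hits the walks from the start to later vertices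

    module _ (adm : Admissible G s) where

      Unmissed : Fin n → Set
      Unmissed u = ∀ {v} → u ≺ v → ¬ Walk (Miss u) s v

      module _ (u : Fin n) (unmissed : ∀ {a} → a ≺ u → Unmissed a) where

        -- The conditions on the stretch before `q`, where `v` is the first vertex after `u` on the
        -- walk and `q` the first neighbour of `v` on the part before `v`.
        Inner : Fin n → Fin n → Set
        Inner v w = (Miss u w × ¬ u ≺ w) × ¬ Adj G v w

        module _ {v q q′ : Fin n} (u≺v : u ≺ v) (v-miss : Miss u v) (W : Walk (Inner v) s q′)
                 (q′~q : Adj G q′ q) (q~v : Adj G q v) (q-miss : Miss u q) (q≺u : q ≺ u)
                 (v-hits : ¬ Walk (Miss v) s u) where

          Inner⇒Miss : ∀ {w} → Inner v w → Miss v w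
          Inner⇒Miss ((_ , u⊀w) , v≁w) = [ (λ { refl → u⊀w u≺v }) , v≁w ]′

          walk-to-q′ : Walk (Miss v) s q′
          walk-to-q′ = walk-map Inner⇒Miss W

          -- By induction `a` hits the walk to the later vertex `q′`. Following that walk to the
          -- first hit and then stepping to `a` keeps clear of `v`.
          walk-to : ∀ {a} → a ≺ u → a ≺ q′ → ¬ Adj G a v → Walk (Miss v) s a
          walk-to {a} a≺u a≺q′ a≁v with miss-or-hit (Touches? a) W
          ... | inj₁ missed = ⊥-elim (unmissed a≺u a≺q′ (walk-map proj₂ missed))
          ... | inj₂ hit with FirstHit⇒Walk hit
          ...   | _ , V , inj₁ refl = walk-map Inner⇒Miss V
          ...   | _ , V , inj₂ a~p  = extend (walk-map Inner⇒Miss V) (Adj-sym a~p)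
                  [ (λ { refl → <-asym a≺u u≺v }) , a≁v ∘ Adj-sym ]′

          -- With d, e, f the first differences of (u,v), (d,q), (q,u), the order is
          -- f ≺ e ≺ q′ ≺ d ≺ q ≺ u ≺ v.  Since v hits the walk s … e d u only in e, also e ~ u,
          -- which forces f; then f ~ d but f ≁ v, and v misses the walk s … f d u.
          no-detour : ⊥
          no-detour
            with d , d≺q , d~u , d≁v , u≈v ← first-difference q≺u u≺v q~v (q-miss ∘ inj₂ ∘ Adj-sym)
            = via-d d≺q d~u d≁v u≈v
            where
            via-d : ∀ {d} → d ≺ q → Adj G d u → ¬ Adj G d v →
              (∀ {m} → m ≺ d → adj G m u ≡ adj G m v) → ⊥
            via-d {d} d≺q d~u d≁v u≈v = q′-earlier (≺-connex q′ d q′≢d)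
              where
              d≺u : d ≺ u
              d≺u = <-trans d≺q q≺u

              -- As `d` is adjacent to `u`, such a walk would extend to an `s`-`u` walk that `v`
              -- misses.
              not-to-d : ¬ Walk (Miss v) s d
              not-to-d V = v-hits (extend V d~u
                [ (λ { refl → <-irrefl refl u≺v }) , v-miss ∘ inj₂ ∘ Adj-sym ]′)

              not-next-to-d : ∀ {a} → Walk (Miss v) s a → ¬ Adj G a d
              not-next-to-d V a~d = not-to-d (extend V a~d
                [ (λ { refl → <-asym d≺u u≺v }) , d≁v ∘ Adj-sym ]′)

              q′≢d : q′ ≢ d
              q′≢d refl = not-to-d walk-to-q′

              q′-earlier : q′ ≺ d ⊎ d ≺ q′ → ⊥
              q′-earlier (inj₂ d≺q′) = not-to-d (walk-to d≺u d≺q′ d≁v)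
              q′-earlier (inj₁ q′≺d)
                with e , e≺q′ , e~d , e≁q , d≈q ←
                       first-difference q′≺d d≺q q′~q (not-next-to-d walk-to-q′)
                with e≺d ← <-trans e≺q′ q′≺d
                with e≺q ← <-trans e≺d d≺q
                with Adj? e v
              ... | no e≁v = not-next-to-d (walk-to (<-trans e≺q q≺u) e≺q′ e≁v) e~d
              ... | yes e~v
                with f , f≺e , f~q , f≁u , _ ←
                       first-difference e≺q q≺u (subst T (sym (u≈v e≺d)) e~v) e≁q
                = not-next-to-d
                    (walk-to (<-trans f≺e (<-trans e≺q q≺u)) (<-trans f≺e e≺q′)
                             (λ f~v → f≁u (subst T (sym (u≈v (<-trans f≺e e≺d))) f~v)))
                    (subst T (sym (d≈q f≺e)) f~q)

        unmissed-step : Unmissed u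
        -- Pass from `v` to the first vertex `w` after `u` on the walk, then to the first neighbour
        -- `q` of `w` before it; all vertices before `q` then satisfy `Inner w`.
        unmissed-step u≺v W with first-hit (λ w → toℕ (pos u) <? toℕ (pos w)) W u≺v
        ... | _ , _ , u≺w , inj₁ refl = ⊀s u≺w
        ... | w , w-miss , u≺w , inj₂ (_ , V , q₀~w)
          with first-hit (Adj? w) V (Adj-sym q₀~w)
        ...   | q , (q-miss , u⊀q) , w~q , loc = shortcut loc
          where
          q≺u : q ≺ u
          q≺u = [ id , (λ u≺q → contradiction u≺q u⊀q) ]′ (≺-connex q u (q-miss ∘ inj₁))

          shortcut : Approach (Inner w) s q → ⊥
          -- If `q` is `s`, the first difference of `u` and `w` would precede the start vertex.
          shortcut (inj₁ refl) =
            ⊀s (proj₁ (proj₂ (first-difference q≺u u≺w (Adj-sym w~q) (q-miss ∘ inj₂ ∘ Adj-sym))))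
          -- Since `u` misses the walk through `q₀` to `w`, admissibility makes `w` hit every
          -- `s`-`u` walk.
          shortcut (inj₂ (_ , W′ , q′~q)) =
            no-detour u≺w w-miss W′ q′~q (Adj-sym w~q) q-miss q≺u
              (admissible⇒no-mutual-miss adm (≺⇒≢ u≺w)
                (extend (walk-map proj₁ V) q₀~w w-miss))

      unmissed : ∀ u → Unmissed u
      unmissed u = <-rec (λ r → ∀ u → toℕ (pos u) ≡ r → Unmissed u)
        (λ _ rec u eq → unmissed-step u
          (λ {a} a≺u → rec (subst (toℕ (pos a) <_) eq a≺u) a refl))
        (toℕ (pos u)) u refl

      -- The dominating pair property and the AT-free order

      monotone : MonotoneDomPairOrder G τ
      monotone i k p (p~ , _) (p₀ , pₖ) _ v (j , j≤i , refl)
        with any? (λ l → Touches? v (p l))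
      ... | yes hit = hit
      ... | no  missed with m≤n⇒m<n∨m≡n j≤i
      -- Here `v` is the end of the path itself.
      ...   | inj₂ j≡i = contradiction
                (fromℕ k , inj₁ (trans pₖ (cong τ (sym (toℕ-injective j≡i))))) missed
      ...   | inj₁ j<i = ⊥-elim (unmissed v
                (subst₂ (λ a b → toℕ a < toℕ b) (sym (pos-τ j)) (sym (pos-τ i)) j<i)
                (subst₂ (Walk (Miss v)) (trans p₀ (proj₁ (proj₂ lbfs) i)) pₖ
                  (IsWalk⇒Walk k p p~ (λ l t → missed (l , t)))))

      common-neighbour : ∀ {x y z} → Connected G → x ≺ y → z ≺ y →
        Walk (Miss z) x y → Walk (Miss x) z y → ∃ λ w → Adj G x w × Adj G z w
      common-neighbour {x} {y} {z} conn x≺y z≺y X Z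
        with k , p , (p~ , _) , (refl , refl) ← conn s y
        with miss-or-hit (λ w → Touches? x w ⊎-dec Touches? z w)
               -- `w ≡ w` serves as the trivially true predicate.
               (IsWalk⇒Walk {P = λ w → w ≡ w} k p p~ (λ _ → refl))
      ... | inj₁ missed = ⊥-elim (unmissed x x≺y (walk-map (λ m → proj₂ m ∘ inj₁) missed))
      ... | inj₂ (w , _ , hit , loc) =
        w , adjacent (walk-source Z) (touches-x hit) (touches-z hit)
          , adjacent (walk-source X) (touches-z hit) (touches-x hit)
        where
        Hit : Fin n → Set
        Hit t = Touches x t ⊎ Touches z t

        walk-to-w : ∀ {R : Fin n → Set} → (∀ {t} → ¬ Hit t → R t) → R w → Walk R s w
        walk-to-w f Rw = Approach⇒Walk (f ∘ proj₂) Rw loc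

        -- If `b` missed `w`, going from `s` to `w`, on to `a` and along `A` would give a walk to
        -- the later vertex `y` that `b` misses.
        transfer : ∀ {a b} → b ≺ y → Walk (Miss b) a y → (∀ {t} → ¬ Hit t → Miss b t) →
          Touches a w → Touches b w
        transfer {a} {b} b≺y A f touch with Touches? b w
        ... | yes t = t
        ... | no ¬t = ⊥-elim (unmissed b b≺y (continue touch))
          where
          continue : Touches a w → Walk (Miss b) s y
          continue (inj₁ refl) = walk-++ (walk-to-w f ¬t) A
          continue (inj₂ a~w)  =
            walk-++ (extend (walk-to-w f ¬t) (Adj-sym a~w) (walk-source A)) A

        touches-x : Hit w → Touches x w
        touches-x (inj₁ t) = t
        touches-x (inj₂ t) = transfer x≺y Z (_∘ inj₁) t

        touches-z : Hit w → Touches z w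
        touches-z (inj₁ t) = transfer z≺y X (_∘ inj₂) t
        touches-z (inj₂ t) = t

        -- `w` cannot be `a`, because `b` touches `w` but not `a`.
        adjacent : ∀ {a b} → Miss a b → Touches a w → Touches b w → Adj G a w
        adjacent _    (inj₂ a~w)  _           = a~w
        adjacent miss (inj₁ refl) (inj₁ refl) = contradiction (inj₁ refl) miss
        adjacent miss (inj₁ refl) (inj₂ b~a)  = contradiction (inj₂ (Adj-sym b~a)) miss

      middle-not-last : ∀ {x y z} → Connected G → ATFree G → NoBadClaw G →
        DomBetween G x y z → x ≺ y → ¬ z ≺ y
      middle-not-last {x} {y} {z} conn atFree noClaw B@(x≢y , y≢z , x≢z , xy , yz) x≺y z≺y
        = let w , x~w , z~w = common-neighbour conn x≺y z≺y X Z
          in claw-or-triple x~w z~w (Adj? y w)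
        where
        xy-path : PathAvoiding G x y z
        xy-path = ChordlessAvoiding⇒PathAvoiding xy

        yz-path : PathAvoiding G y z x
        yz-path = ChordlessAvoiding⇒PathAvoiding yz

        X : Walk (Miss z) x y
        X = PathAvoiding⇒Walk x≢z xy-path

        Z : Walk (Miss x) z y
        Z = walk-reverse (PathAvoiding⇒Walk (x≢y ∘ sym) yz-path)

        x≁z : ¬ Adj G x z
        x≁z = walk-source Z ∘ inj₂

        x≁y : ¬ Adj G x y
        x≁y = walk-target Z ∘ inj₂

        z≁y : ¬ Adj G z y
        z≁y = walk-target X ∘ inj₂

        claw-or-triple : ∀ {w} → Adj G x w → Adj G z w → Dec (Adj G y w) → ⊥
        claw-or-triple {w} x~w z~w (yes y~w) = noClaw x z y w
          (x≢z , x≢y , y≢z ∘ sym , Adj-sym x~w , Adj-sym z~w , Adj-sym y~w , x≁z , x≁y , z≁y , B)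
        claw-or-triple x~w z~w (no y≁w) = atFree x y z
          (x≢y , y≢z , x≢z , x≁y , z≁y ∘ Adj-sym , x≁z , xy-path , yz-path ,
           -- The third path comes from `x`, `w`, `z`, built in reverse. `y` misses `w`: they are
           -- not adjacent by `y≁w`, and they differ because `x` is adjacent to `w` but not to `y`.
           ChordlessAvoiding⇒PathAvoiding (Walk⇒ChordlessAvoiding
             (extend (extend (start [ y≢z ∘ sym , z≁y ∘ Adj-sym ]′)
                       z~w [ (λ { refl → x≁y x~w }) , y≁w ]′)
                     (Adj-sym x~w) [ x≢y , x≁y ∘ Adj-sym ]′)))

      atFreeOrder : Connected G → ATFree G → NoBadClaw G → ATFreeOrder G τ
      atFreeOrder conn atFree noClaw x y z B@(x≢y , y≢z , _)
        with ≺-connex y x (x≢y ∘ sym) | ≺-connex y z y≢z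
      ... | inj₁ y≺x | _        = inj₁ (pos y , pos x , τ-pos y , τ-pos x , y≺x)
      ... | inj₂ _   | inj₁ y≺z = inj₂ (pos y , pos z , τ-pos y , τ-pos z , y≺z)
      ... | inj₂ x≺y | inj₂ z≺y = ⊥-elim (middle-not-last conn atFree noClaw B x≺y z≺y)

theorem6 : ∀ {n : ℕ} (G : Graph n) → Connected G → ATFree G → NoBadClaw G →
    ∀ (s : Fin n) → Admissible G s →
    ∀ (τ : Fin n → Fin n) → IsLBFS G s τ →
    ATFreeOrder G τ × MonotoneDomPairOrder G τ
theorem6 G conn atFree noClaw s adm τ lbfs =
  LBFS.atFreeOrder G s τ lbfs adm conn atFree noClaw , LBFS.monotone G s τ lbfs adm
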